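{- Let $n,\ell\geq 1$ be integers, let $q_1,q_2:\{1,\ldots,n\}\to\{1,\ldots,\ell\}$ be two length-$n$ level-$\ell$ sequences, and let $Q=[q_1,q_2]$. Let $A_Q$ be the $\ell\times\ell$ matrix whose entry $A_Q(a,b)$ is the number of indices $i\in\{1,\ldots,n\}$ with $q_1(i)=a$ and $q_2(i)=b$. Then the distance between the sequence patterns $\langle q_1\rangle$ and $\langle q_2\rangle$ is $$d(\langle q_1\rangle,\langle q_2\rangle) = n-\max_{\Phi\in S_\ell^2}\operatorname{tr}(P_\Phi A_Q).$$
   Context: Let $N=\{1,\ldots,n\}$ and $L=\{1,\ldots,\ell\}$. A length-$n$ level-$\ell$ sequence is a function $q:N\to L$. The symmetric group $S_\ell$ acts on such sequences by relabeling symbols: $\phi(q)=\phi\circ q$. The sequence pattern $\langle q\rangle$ is the orbit of $q$ under this action. For two sequences $q,p$, the Hamming distance $d(q,p)$ is the number of $i\in N$ with $q(i)\neq p(i)$. For two sequence patterns, $d(t_1,t_2)=\min\{d(q,p): q\in t_1,\ p\in t_2\}$. For $\phi\in S_\ell$ let $P_\phi$ be the $\ell\times\ell$ permutation matrix with $P_\phi(\phi(a),a)=1$ for all $a\in L$ and all other entries $0$. For $\Phi=[\phi_1,\phi_2]\in S_\ell^2=S_\ell\times S_\ell$, put $P_\Phi=P_{\phi_2}^{T}P_{\phi_1}$, so that $\operatorname{tr}(P_\Phi A)=\operatorname{tr}(P_{\phi_1}AP_{\phi_2}^{T})$ is the trace of the matrix obtained from $A$ by permuting rows by $\phi_1$ and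 columns by $\phi_2$. -}

module Defs where

open import Data.Bool.Base using (if_then_else_)
open import Data.Fin.Base using (Fin)
open import Data.Fin.Permutation using (Permutation′; _⟨$⟩ʳ_)
open import Data.Fin.Properties using (_≟_)
open import Data.Nat.Base using (ℕ; _*_; _≤_)
open import Data.Nat.Properties using (+-*-semiring)
open import Data.Product.Base using (_×_; _,_; ∃; ∃₂)
open import Data.Vec.Base using (allFin; count)
open import Algebra.Properties.Semiring.Sum +-*-semiring using (sum-syntax)
open import Level using (0ℓ)
open import Relation.Binary.PropositionalEquality.Core using (_≡_; _≗_)
open import Relation.Nullary.Decidable.Core using (does; ¬?; _×-dec_)
open import Relation.Unary using (Pred; _∈_)

IsMinimum : Pred ℕ 0ℓ → ℕ → Set
IsMinimum S m = m ∈ S × (∀ {k} → k ∈ S → m ≤ k)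

IsMaximum : Pred ℕ 0ℓ → ℕ → Set
IsMaximum S m = m ∈ S × (∀ {k} → k ∈ S → k ≤ m)

Sequence : ℕ → ℕ → Set
Sequence n ℓ = Fin n → Fin ℓ

infixr 7 _•_

_•_ : ∀ {n ℓ} → Permutation′ ℓ → Sequence n ℓ → Sequence n ℓ
(φ • q) i = φ ⟨$⟩ʳ q i

-- Sequences are compared pointwise, since function extensionality is not
-- available.
⟨_⟩ : ∀ {n ℓ} → Sequence n ℓ → Pred (Sequence n ℓ) 0ℓ
⟨_⟩ {ℓ = ℓ} q p = ∃ λ (φ : Permutation′ ℓ) → p ≗ φ • q

hamming : ∀ {n ℓ} → Sequence n ℓ → Sequence n ℓ → ℕ
hamming {n} q p = count (λ i → ¬? (q i ≟ p i)) (allFin n)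

-- d = min { hamming q p : q ∈ t₁, p ∈ t₂ }, as a relation determining d
-- uniquely.
IsPatternDistance : ∀ {n ℓ} (t₁ t₂ : Pred (Sequence n ℓ) 0ℓ) → ℕ → Set
IsPatternDistance t₁ t₂ =
  IsMinimum (λ k → ∃₂ λ q p → q ∈ t₁ × p ∈ t₂ × k ≡ hamming q p)

Matrix : ℕ → Set
Matrix ℓ = Fin ℓ → Fin ℓ → ℕ

infixl 7 _⊗_
infix  8 _ᵀ

_⊗_ : ∀ {ℓ} → Matrix ℓ → Matrix ℓ → Matrix ℓ
_⊗_ {ℓ} A B a c = ∑[ b < ℓ ] (A a b * B b c)

_ᵀ : ∀ {ℓ} → Matrix ℓ → Matrix ℓ
(A ᵀ) a b = A b a

tr : ∀ {ℓ} → Matrix ℓ → ℕ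
tr {ℓ} A = ∑[ a < ℓ ] A a a

permMatrix : ∀ {ℓ} → Permutation′ ℓ → Matrix ℓ
permMatrix φ b a = if does (b ≟ φ ⟨$⟩ʳ a) then 1 else 0

P[_] : ∀ {ℓ} → Permutation′ ℓ × Permutation′ ℓ → Matrix ℓ
P[ φ₁ , φ₂ ] = permMatrix φ₂ ᵀ ⊗ permMatrix φ₁

A[_] : ∀ {n ℓ} → Sequence n ℓ × Sequence n ℓ → Matrix ℓ
A[_] {n} (q₁ , q₂) a b = count (λ i → (q₁ i ≟ a) ×-dec (q₂ i ≟ b)) (allFin n)

IsMaxTrace : ∀ {ℓ} → Matrix ℓ → ℕ → Set
IsMaxTrace {ℓ} A =
  IsMaximum (λ k → ∃ λ (Φ : Permutation′ ℓ × Permutation′ ℓ) → k ≡ tr (P[ Φ ] ⊗ A))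

{-# OPTIONS --safe #-}
module Submission where

-- For fixed relabellings Φ = (φ₁ , φ₂), the trace of P[ Φ ] ⊗ A[ q₁ , q₂ ]
-- counts the positions where φ₁ • q₁ and φ₂ • q₂ agree, while their Hamming
-- distance counts the positions where they disagree; the two add up to n.
-- So a Φ minimising the distance maximises the trace, and such a Φ exists
-- because there are finitely many permutations up to pointwise equality.

open import Defs
open import Data.Bool.Base using (true; false; if_then_else_)
open import Data.Fin.Base using (Fin; zero; suc; punchIn)
open import Data.Fin.Permutation
  using (Permutation; Permutation′; _⟨$⟩ʳ_; _≈_; id; insert; remove; insert-remove)
open import Data.Fin.Properties using (_≟_)
open import Data.Integer.Base using (+_; _-_; _⊖_)
open import Data.Integer.Properties using (m-n≡m⊖n; ⊖-≥)
open import Data.List.Base as List using (List; []; _∷_; cartesianProduct; cartesianProductWith)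
import Data.List.Membership.Propositional as List
open import Data.List.Membership.Propositional.Properties
  using (∈-allFin; ∈-cartesianProduct⁺; ∈-cartesianProductWith⁺)
open import Data.List.Relation.Unary.All as All using ()
open import Data.List.Relation.Unary.Any using (here)
open import Data.Nat.Base using (ℕ; zero; suc; _+_; _*_; _∸_; _≤_; _≥_)
open import Data.Nat.Properties
  using (+-*-semiring; ≤-totalOrder; +-identityʳ; +-suc; *-comm; *-assoc; ≤-trans;
         ≤-reflexive; +-cancelˡ-≤; +-monoˡ-≤; m≤n+m; m+n∸n≡m; module ≤-Reasoning)
open import Algebra.Properties.Semiring.Sum +-*-semiring
  using (sum-syntax; sum-cong-≗; sum-replicate-zero; ∑-comm; *-distribˡ-sum)
open import Data.List.Extrema ≤-totalOrder using (argmin; f[argmin]≤f[xs])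
open import Data.Product.Base using (_×_; _,_; proj₁; proj₂; ∃; ∃₂)
open import Data.Vec.Base using (Vec; []; _∷_; allFin; count; tabulate)
open import Function.Base using (_∘_)
open import Function.Bundles using (mk⇔)
open import Relation.Binary.PropositionalEquality
  using (_≡_; _≗_; refl; sym; trans; cong; cong₂; module ≡-Reasoning)
open import Relation.Nullary.Decidable using (Dec; yes; no; does; ¬?; _×-dec_; does-⇔)
open import Relation.Unary using (Decidable)

-- Unfolds to the same `if_then_else_` as the entries of `permMatrix`, so the two agree
-- definitionally.
𝟙 : ∀ {p} {P : Set p} → Dec P → ℕ
𝟙 P? = if does P? then 1 else 0

𝟙-×-dec : ∀ {p q} {P : Set p} {Q : Set q} (P? : Dec P) (Q? : Dec Q) →
  𝟙 (P? ×-dec Q?) ≡ 𝟙 P? * 𝟙 Q?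
𝟙-×-dec P? Q? with does P? | does Q?
... | true  | true  = refl
... | true  | false = refl
... | false | _     = refl

𝟙-≟-sym : ∀ {n} (a b : Fin n) → 𝟙 (a ≟ b) ≡ 𝟙 (b ≟ a)
𝟙-≟-sym a b =
  cong (if_then 1 else 0) (does-⇔ (mk⇔ sym sym) (a ≟ b) (b ≟ a))

-- Sifting property of the Kronecker delta, used to eliminate every sum over symbols.
sum-𝟙-≟ : ∀ {n} (a : Fin n) (f : Fin n → ℕ) → ∑[ b < n ] (𝟙 (a ≟ b) * f b) ≡ f a
sum-𝟙-≟ {suc n} zero f = begin
  f zero + 0 + ∑[ b < n ] 0  ≡⟨ cong₂ _+_ (+-identityʳ (f zero)) (sum-replicate-zero n) ⟩
  f zero + 0                 ≡⟨ +-identityʳ (f zero) ⟩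
  f zero                     ∎
  where open ≡-Reasoning
-- The term at `zero` computes to 0, and `suc a ≟ suc b` decides exactly as `a ≟ b` does.
sum-𝟙-≟ (suc a) f = sum-𝟙-≟ a (f ∘ suc)

-- Since `allFin n` is a tabulation, this turns the counts in `hamming` and `A[_]` into sums, which
-- can be rewritten pointwise and interchanged.
count-tabulate : ∀ {a p} {A : Set a} {P : A → Set p} (P? : Decidable P) →
  ∀ {n} (f : Fin n → A) → count P? (tabulate f) ≡ ∑[ i < n ] 𝟙 (P? (f i))
count-tabulate P? {zero}  f = refl
count-tabulate P? {suc n} f with does (P? (f zero))
... | true  = cong suc (count-tabulate P? (f ∘ suc))
... | false = count-tabulate P? (f ∘ suc)

count-¬+count : ∀ {a p} {A : Set a} {P : A → Set p} (P? : Decidable P) →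
  ∀ {n} (xs : Vec A n) → count (¬? ∘ P?) xs + count P? xs ≡ n
count-¬+count P? []       = refl
count-¬+count P? (x ∷ xs) with does (P? x)
... | true  = trans (+-suc _ _) (cong suc (count-¬+count P? xs))
... | false = cong suc (count-¬+count P? xs)

hamming-cong : ∀ {n ℓ} {p p′ q q′ : Sequence n ℓ} →
  p ≗ p′ → q ≗ q′ → hamming p q ≡ hamming p′ q′
hamming-cong {n} {p = p} {p′} {q} {q′} p≗p′ q≗q′ = begin
  hamming p q                        ≡⟨ count-tabulate (λ i → ¬? (p i ≟ q i)) (λ i → i) ⟩
  ∑[ i < n ] 𝟙 (¬? (p i ≟ q i))      ≡⟨ sum-cong-≗ (λ i → cong₂ (λ a b → 𝟙 (¬? (a ≟ b))) (p≗p′ i) (q≗q′ i)) ⟩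
  ∑[ i < n ] 𝟙 (¬? (p′ i ≟ q′ i))    ≡⟨ count-tabulate (λ i → ¬? (p′ i ≟ q′ i)) (λ i → i) ⟨
  hamming p′ q′                      ∎
  where open ≡-Reasoning

-- In the sum defining the product, the first delta leaves only the term `c = φ₂ ⟨$⟩ʳ a`.
P-entry : ∀ {ℓ} (φ₁ φ₂ : Permutation′ ℓ) a b →
  P[ φ₁ , φ₂ ] a b ≡ 𝟙 (φ₂ ⟨$⟩ʳ a ≟ φ₁ ⟨$⟩ʳ b)
P-entry {ℓ} φ₁ φ₂ a b = begin
  ∑[ c < ℓ ] (𝟙 (c ≟ φ₂ ⟨$⟩ʳ a) * 𝟙 (c ≟ φ₁ ⟨$⟩ʳ b))
    ≡⟨ sum-cong-≗ (λ c → cong (_* 𝟙 (c ≟ φ₁ ⟨$⟩ʳ b)) (𝟙-≟-sym c (φ₂ ⟨$⟩ʳ a))) ⟩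
  ∑[ c < ℓ ] (𝟙 (φ₂ ⟨$⟩ʳ a ≟ c) * 𝟙 (c ≟ φ₁ ⟨$⟩ʳ b))
    ≡⟨ sum-𝟙-≟ (φ₂ ⟨$⟩ʳ a) (λ c → 𝟙 (c ≟ φ₁ ⟨$⟩ʳ b)) ⟩
  𝟙 (φ₂ ⟨$⟩ʳ a ≟ φ₁ ⟨$⟩ʳ b)
    ∎
  where open ≡-Reasoning

A-entry : ∀ {n ℓ} (q₁ q₂ : Sequence n ℓ) a b →
  A[ q₁ , q₂ ] a b ≡ ∑[ i < n ] (𝟙 (q₁ i ≟ a) * 𝟙 (q₂ i ≟ b))
A-entry q₁ q₂ a b = trans
  (count-tabulate (λ i → (q₁ i ≟ a) ×-dec (q₂ i ≟ b)) (λ i → i))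
  (sum-cong-≗ (λ i → 𝟙-×-dec (q₁ i ≟ a) (q₂ i ≟ b)))

-- `A[ q₁ , q₂ ]` is a sum of elementary matrices, one per position `i`, with a 1 at row `q₁ i`,
-- column `q₂ i`. By linearity each contributes one entry of `W`, with row and column swapped by the
-- trace.
tr-⊗-A : ∀ {n ℓ} (W : Matrix ℓ) (q₁ q₂ : Sequence n ℓ) →
  tr (W ⊗ A[ q₁ , q₂ ]) ≡ ∑[ i < n ] W (q₂ i) (q₁ i)
tr-⊗-A {n} {ℓ} W q₁ q₂ = begin
  ∑[ a < ℓ ] ∑[ b < ℓ ] (W a b * A[ q₁ , q₂ ] b a)
    ≡⟨ sum-cong-≗ row ⟩
  ∑[ a < ℓ ] ∑[ i < n ] (𝟙 (q₂ i ≟ a) * W a (q₁ i))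
    ≡⟨ ∑-comm (λ a i → 𝟙 (q₂ i ≟ a) * W a (q₁ i)) ⟩
  ∑[ i < n ] ∑[ a < ℓ ] (𝟙 (q₂ i ≟ a) * W a (q₁ i))
    ≡⟨ sum-cong-≗ (λ i → sum-𝟙-≟ (q₂ i) (λ a → W a (q₁ i))) ⟩
  ∑[ i < n ] W (q₂ i) (q₁ i)
    ∎
  where
  open ≡-Reasoning

  -- Brings the delta in `b` to the front for sifting, and keeps the delta in `a` ready for the
  -- outer sum.
  rearrange : ∀ w u v → w * (u * v) ≡ u * (v * w)
  rearrange w u v = trans (*-comm w (u * v)) (*-assoc u v w)

  row : ∀ a → ∑[ b < ℓ ] (W a b * A[ q₁ , q₂ ] b a) ≡
              ∑[ i < n ] (𝟙 (q₂ i ≟ a) * W a (q₁ i))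
  row a = begin
    ∑[ b < ℓ ] (W a b * A[ q₁ , q₂ ] b a)
      ≡⟨ sum-cong-≗ (λ b → trans
           (cong (W a b *_) (A-entry q₁ q₂ b a))
           (*-distribˡ-sum (W a b) (λ i → 𝟙 (q₁ i ≟ b) * 𝟙 (q₂ i ≟ a)))) ⟩
    ∑[ b < ℓ ] ∑[ i < n ] (W a b * (𝟙 (q₁ i ≟ b) * 𝟙 (q₂ i ≟ a)))
      ≡⟨ ∑-comm (λ b i → W a b * (𝟙 (q₁ i ≟ b) * 𝟙 (q₂ i ≟ a))) ⟩
    ∑[ i < n ] ∑[ b < ℓ ] (W a b * (𝟙 (q₁ i ≟ b) * 𝟙 (q₂ i ≟ a)))
      ≡⟨ sum-cong-≗ (λ i → sum-cong-≗ (λ b → rearrange (W a b) (𝟙 (q₁ i ≟ b)) (𝟙 (q₂ i ≟ a)))) ⟩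
    ∑[ i < n ] ∑[ b < ℓ ] (𝟙 (q₁ i ≟ b) * (𝟙 (q₂ i ≟ a) * W a b))
      ≡⟨ sum-cong-≗ (λ i → sum-𝟙-≟ (q₁ i) (λ b → 𝟙 (q₂ i ≟ a) * W a b)) ⟩
    ∑[ i < n ] (𝟙 (q₂ i ≟ a) * W a (q₁ i))
      ∎

tr≡agreements : ∀ {n ℓ} (φ₁ φ₂ : Permutation′ ℓ) (q₁ q₂ : Sequence n ℓ) →
  tr (P[ φ₁ , φ₂ ] ⊗ A[ q₁ , q₂ ]) ≡
  count (λ i → (φ₁ • q₁) i ≟ (φ₂ • q₂) i) (allFin n)
tr≡agreements {n} φ₁ φ₂ q₁ q₂ = begin
  tr (P[ φ₁ , φ₂ ] ⊗ A[ q₁ , q₂ ])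
    ≡⟨ tr-⊗-A P[ φ₁ , φ₂ ] q₁ q₂ ⟩
  ∑[ i < n ] P[ φ₁ , φ₂ ] (q₂ i) (q₁ i)
    ≡⟨ sum-cong-≗ (λ i → trans (P-entry φ₁ φ₂ (q₂ i) (q₁ i)) (𝟙-≟-sym ((φ₂ • q₂) i) ((φ₁ • q₁) i))) ⟩
  ∑[ i < n ] 𝟙 ((φ₁ • q₁) i ≟ (φ₂ • q₂) i)
    ≡⟨ count-tabulate (λ i → (φ₁ • q₁) i ≟ (φ₂ • q₂) i) (λ i → i) ⟨
  count (λ i → (φ₁ • q₁) i ≟ (φ₂ • q₂) i) (allFin n)
    ∎
  where open ≡-Reasoning

hamming+tr≡n : ∀ {n ℓ} (φ₁ φ₂ : Permutation′ ℓ) (q₁ q₂ : Sequence n ℓ) →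
  hamming (φ₁ • q₁) (φ₂ • q₂) + tr (P[ φ₁ , φ₂ ] ⊗ A[ q₁ , q₂ ]) ≡ n
hamming+tr≡n {n} φ₁ φ₂ q₁ q₂ = trans
  (cong (λ t → hamming (φ₁ • q₁) (φ₂ • q₂) + t) (tr≡agreements φ₁ φ₂ q₁ q₂))
  (count-¬+count (λ i → (φ₁ • q₁) i ≟ (φ₂ • q₂) i) (allFin n))

insert-cong : ∀ {m n} i j {π ρ : Permutation m n} → π ≈ ρ → insert i j π ≈ insert i j ρ
insert-cong i j π≈ρ k with i ≟ k
... | yes _ = refl
... | no  _ = cong (punchIn j) (π≈ρ _)

-- A permutation of `suc n` points amounts to the image of `zero` together with a permutation of the
-- remaining `n` points.
permutations : ∀ n → List (Permutation′ n)
permutations zero    = id ∷ []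
permutations (suc n) = cartesianProductWith (insert zero) (List.allFin (suc n)) (permutations n)

permutations-complete : ∀ {n} (π : Permutation′ n) →
  ∃ λ σ → σ List.∈ permutations n × σ ≈ π
permutations-complete {zero}  π = id , here refl , λ ()
permutations-complete {suc n} π with permutations-complete (remove zero π)
... | σ , σ∈ , σ≈ =
  insert zero π₀ σ ,
  ∈-cartesianProductWith⁺ (insert zero) (∈-allFin π₀) σ∈ ,
  λ k → trans (insert-cong zero π₀ {σ} {remove zero π} σ≈ k) (insert-remove zero π k)
  where π₀ = π ⟨$⟩ʳ zero

closest-relabellings : ∀ {n ℓ} (q₁ q₂ : Sequence n ℓ) →
  ∃₂ λ (φ₁ φ₂ : Permutation′ ℓ) → ∀ (ψ₁ ψ₂ : Permutation′ ℓ) →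
  hamming (φ₁ • q₁) (φ₂ • q₂) ≤ hamming (ψ₁ • q₁) (ψ₂ • q₂)
closest-relabellings {ℓ = ℓ} q₁ q₂ = φ₁ , φ₂ , minimal
  where
  distance : Permutation′ ℓ × Permutation′ ℓ → ℕ
  distance (ψ₁ , ψ₂) = hamming (ψ₁ • q₁) (ψ₂ • q₂)

  pairs : List (Permutation′ ℓ × Permutation′ ℓ)
  pairs = cartesianProduct (permutations ℓ) (permutations ℓ)

  best : Permutation′ ℓ × Permutation′ ℓ
  -- The default `(id , id)` is itself a pair of relabellings, so `best` is an admissible choice
  -- even if the default is returned.
  best = argmin distance (id , id) pairs

  φ₁ φ₂ : Permutation′ ℓ
  φ₁ = proj₁ best
  φ₂ = proj₂ best

  minimal : ∀ ψ₁ ψ₂ → distance best ≤ distance (ψ₁ , ψ₂)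
  minimal ψ₁ ψ₂ with permutations-complete ψ₁ | permutations-complete ψ₂
  ... | σ₁ , σ₁∈ , σ₁≈ψ₁ | σ₂ , σ₂∈ , σ₂≈ψ₂ = begin
    -- Minimality is known only over the list, so `ψ₁` and `ψ₂` are replaced by their listed
    -- representatives, which act identically on symbols.
    distance best       ≤⟨ All.lookup (f[argmin]≤f[xs] (id , id) pairs) (∈-cartesianProduct⁺ σ₁∈ σ₂∈) ⟩
    distance (σ₁ , σ₂)  ≡⟨ hamming-cong (σ₁≈ψ₁ ∘ q₁) (σ₂≈ψ₂ ∘ q₂) ⟩
    distance (ψ₁ , ψ₂)  ∎
    where open ≤-Reasoning

m+n≡o⇒+m≡+o-+n : ∀ {m n o} → m + n ≡ o → + m ≡ + o - + n
m+n≡o⇒+m≡+o-+n {m} {n} refl = sym (begin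
  + (m + n) - + n    ≡⟨ m-n≡m⊖n (m + n) n ⟩
  -- As `n ≤ m + n`, the integer difference agrees with truncated subtraction.
  (m + n) ⊖ n        ≡⟨ ⊖-≥ (m≤n+m n m) ⟩
  + (m + n ∸ n)      ≡⟨ cong +_ (m+n∸n≡m m n) ⟩
  + m                ∎)
  where open ≡-Reasoning

-- Converts minimality of the distance into maximality of the trace: `a + d ≤ c + d = a + b`, and
-- `a` cancels.
≤-complement : ∀ {a b c d o} → a + b ≡ o → c + d ≡ o → a ≤ c → d ≤ b
≤-complement {a} {b} {c} {d} {o} a+b≡o c+d≡o a≤c = +-cancelˡ-≤ a d b (begin
  a + d  ≤⟨ +-monoˡ-≤ d a≤c ⟩
  c + d  ≡⟨ trans c+d≡o (sym a+b≡o) ⟩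
  a + b  ∎)
  where open ≤-Reasoning

mainTheorem2 : (n ℓ : ℕ) → n ≥ 1 → ℓ ≥ 1 → (q₁ q₂ : Sequence n ℓ) →
    ∃₂ λ (d M : ℕ) →
    IsPatternDistance ⟨ q₁ ⟩ ⟨ q₂ ⟩ d ×
    IsMaxTrace A[ q₁ , q₂ ] M ×
    + d ≡ + n - + M
mainTheorem2 n ℓ _ _ q₁ q₂ with closest-relabellings q₁ q₂
... | φ₁ , φ₂ , minimal =
  hamming (φ₁ • q₁) (φ₂ • q₂) ,
  tr (P[ φ₁ , φ₂ ] ⊗ A[ q₁ , q₂ ]) ,
  ( (φ₁ • q₁ , φ₂ • q₂ , (φ₁ , λ _ → refl) , (φ₂ , λ _ → refl) , refl)
  -- Orbit members are only pointwise equal to relabelled sequences, hence the passage through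
  -- `hamming-cong`.
  , λ { (q , p , (ψ₁ , q≗) , (ψ₂ , p≗) , refl) →
          ≤-trans (minimal ψ₁ ψ₂) (≤-reflexive (sym (hamming-cong q≗ p≗))) }) ,
  ( ((φ₁ , φ₂) , refl)
  , λ { ((ψ₁ , ψ₂) , refl) →
          ≤-complement (hamming+tr≡n φ₁ φ₂ q₁ q₂) (hamming+tr≡n ψ₁ ψ₂ q₁ q₂) (minimal ψ₁ ψ₂) }) ,
  m+n≡o⇒+m≡+o-+n (hamming+tr≡n φ₁ φ₂ q₁ q₂)
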